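{- Let $q$ be an odd prime power and let $\gamma\in\mathbb{F}_{q^2}$. The polynomial $f(x)=x+\gamma\,\mathrm{Tr}\left(x^{q+3}+x^{2q+2}\right)$ over $\mathbb{F}_{q^2}$ is a permutation polynomial if and only if $\gamma=0$.
   Context: $\mathrm{Tr}:\mathbb{F}_{q^2}\to\mathbb{F}_q$ is the trace map $\mathrm{Tr}(x)=x+x^q$. A polynomial $f$ over $\mathbb{F}_{q^2}$ is a permutation polynomial if the map $x\mapsto f(x)$ is a bijection of $\mathbb{F}_{q^2}$ onto itself. -}

module Defs where

open import Algebra.Bundles using (CommutativeRing)
import Algebra.Properties.Semiring.Exp as Exponentiation
import Algebra.Solver.Ring.NaturalCoefficients.Default as SemiringSolver
open import Data.Fin.Base using (Fin)
open import Data.List.Base using (List; []; _∷_; map)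
open import Data.Nat.Base as ℕ using (ℕ; zero; suc)
open import Data.Nat.Primality using (Prime)
open import Data.Product.Base using (∃; ∃₂; _×_)
open import Function.Bundles using (Inverse)
open import Function.Definitions using (Bijective)
open import Level using (Level; _⊔_) renaming (suc to lsuc)
open import Relation.Binary.PropositionalEquality.Core using (_≡_)
import Relation.Binary.PropositionalEquality.Properties as ≡

IsPrimePower : ℕ → Set
IsPrimePower q = ∃₂ λ p k → Prime p × 1 ℕ.≤ k × q ≡ p ℕ.^ k

record FiniteField (c ℓ : Level) (n : ℕ) : Set (lsuc (c ⊔ ℓ)) where
  field
    commutativeRing : CommutativeRing c ℓ
  open CommutativeRing commutativeRing public
  field
    1≉0         : 1# ≉ 0#
    inverse     : ∀ x → x ≉ 0# → ∃ λ y → x * y ≈ 1#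
    cardinality : Inverse setoid (≡.setoid (Fin n))

-- A polynomial is a list of coefficients, constant term first; trailing zeros
-- are allowed, so different lists can denote the same polynomial.
module Polynomials {c ℓ : Level} (R : CommutativeRing c ℓ) where
  open CommutativeRing R
  open Exponentiation semiring using (_^_; ^-congˡ)
  open SemiringSolver commutativeSemiring using (solve; _:=_; _:+_; _:*_)
  open import Relation.Binary.Reasoning.Setoid setoid

  infixl 6 _⊞_
  infixl 7 _⊠_
  infixr 7 _·_
  infixr 8 _^ᴾ_

  Polynomial : Set c
  Polynomial = List Carrier

  eval : Polynomial → Carrier → Carrier
  eval []      x = 0#
  eval (a ∷ p) x = a + x * eval p x

  IsPermutationPolynomial : Polynomial → Set (c ⊔ ℓ)
  IsPermutationPolynomial p = Bijective _≈_ _≈_ (eval p)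

  X : Polynomial
  X = 0# ∷ 1# ∷ []

  _⊞_ : Polynomial → Polynomial → Polynomial
  []      ⊞ r       = r
  (a ∷ p) ⊞ []      = a ∷ p
  (a ∷ p) ⊞ (b ∷ r) = a + b ∷ p ⊞ r

  _·_ : Carrier → Polynomial → Polynomial
  a · p = map (a *_) p

  _⊠_ : Polynomial → Polynomial → Polynomial
  []      ⊠ r = []
  (a ∷ p) ⊠ r = a · r ⊞ (0# ∷ p ⊠ r)

  _^ᴾ_ : Polynomial → ℕ → Polynomial
  p ^ᴾ zero  = 1# ∷ []
  p ^ᴾ suc n = p ⊠ p ^ᴾ n

  eval-X : ∀ x → eval X x ≈ x
  eval-X x = begin
    0# + x * (1# + x * 0#) ≈⟨ +-identityˡ _ ⟩
    x * (1# + x * 0#)      ≈⟨ *-congˡ (+-congˡ (zeroʳ x)) ⟩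
    x * (1# + 0#)          ≈⟨ *-congˡ (+-identityʳ 1#) ⟩
    x * 1#                 ≈⟨ *-identityʳ x ⟩
    x                      ∎

  eval-⊞ : ∀ p r x → eval (p ⊞ r) x ≈ eval p x + eval r x
  eval-⊞ []      r       x = sym (+-identityˡ _)
  eval-⊞ (a ∷ p) []      x = sym (+-identityʳ _)
  eval-⊞ (a ∷ p) (b ∷ r) x = begin
    a + b + x * eval (p ⊞ r) x            ≈⟨ +-congˡ (*-congˡ (eval-⊞ p r x)) ⟩
    a + b + x * (eval p x + eval r x)     ≈⟨ solve 5 (λ a b x u v → a :+ b :+ x :* (u :+ v) := (a :+ x :* u) :+ (b :+ x :* v)) refl a b x _ _ ⟩
    a + x * eval p x + (b + x * eval r x) ∎

  eval-· : ∀ a p x → eval (a · p) x ≈ a * eval p x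
  eval-· a []      x = sym (zeroʳ a)
  eval-· a (b ∷ p) x = begin
    a * b + x * eval (a · p) x ≈⟨ +-congˡ (*-congˡ (eval-· a p x)) ⟩
    a * b + x * (a * eval p x) ≈⟨ solve 4 (λ a b x u → a :* b :+ x :* (a :* u) := a :* (b :+ x :* u)) refl a b x _ ⟩
    a * (b + x * eval p x)     ∎

  eval-⊠ : ∀ p r x → eval (p ⊠ r) x ≈ eval p x * eval r x
  eval-⊠ []      r x = sym (zeroˡ _)
  eval-⊠ (a ∷ p) r x = begin
    eval (a · r ⊞ (0# ∷ p ⊠ r)) x               ≈⟨ eval-⊞ (a · r) _ x ⟩
    eval (a · r) x + (0# + x * eval (p ⊠ r) x)  ≈⟨ +-cong (eval-· a r x) (+-identityˡ _) ⟩
    a * eval r x + x * eval (p ⊠ r) x           ≈⟨ +-congˡ (*-congˡ (eval-⊠ p r x)) ⟩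
    a * eval r x + x * (eval p x * eval r x)    ≈⟨ solve 4 (λ a x u v → a :* v :+ x :* (u :* v) := (a :+ x :* u) :* v) refl a x _ _ ⟩
    (a + x * eval p x) * eval r x               ∎

  eval-^ : ∀ p n x → eval (p ^ᴾ n) x ≈ eval p x ^ n
  eval-^ p zero    x = begin
    1# + x * 0# ≈⟨ +-congˡ (zeroʳ x) ⟩
    1# + 0#     ≈⟨ +-identityʳ 1# ⟩
    1#          ∎
  eval-^ p (suc n) x = begin
    eval (p ⊠ p ^ᴾ n) x        ≈⟨ eval-⊠ p (p ^ᴾ n) x ⟩
    eval p x * eval (p ^ᴾ n) x ≈⟨ *-congˡ (eval-^ p n x) ⟩
    eval p x * eval p x ^ n    ∎

module _ {c ℓ : Level} (q : ℕ) (F : FiniteField c ℓ (q ℕ.^ 2)) where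
  open FiniteField F
  open Exponentiation semiring using (_^_; ^-congˡ)
  open Polynomials commutativeRing
  open import Relation.Binary.Reasoning.Setoid setoid

  -- The subfield of order q is the set of y with y ^ q ≈ y. The trace takes
  -- values there and is composed here with the inclusion into F.
  Tr : Carrier → Carrier
  Tr x = x + x ^ q

  Trᴾ : Polynomial → Polynomial
  Trᴾ p = p ⊞ p ^ᴾ q

  eval-Tr : ∀ p x → eval (Trᴾ p) x ≈ Tr (eval p x)
  eval-Tr p x = begin
    eval (p ⊞ p ^ᴾ q) x        ≈⟨ eval-⊞ p (p ^ᴾ q) x ⟩
    eval p x + eval (p ^ᴾ q) x ≈⟨ +-congˡ (eval-^ p q x) ⟩
    eval p x + eval p x ^ q    ∎

  tracePolynomial : Carrier → Polynomial
  tracePolynomial γ = X ⊞ γ · Trᴾ (X ^ᴾ (q ℕ.+ 3) ⊞ X ^ᴾ (2 ℕ.* q ℕ.+ 2))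

  eval-tracePolynomial : ∀ γ x →
    eval (tracePolynomial γ) x ≈ x + γ * Tr (x ^ (q ℕ.+ 3) + x ^ (2 ℕ.* q ℕ.+ 2))
  eval-tracePolynomial γ x = begin
    eval (X ⊞ γ · Trᴾ g) x                        ≈⟨ eval-⊞ X (γ · Trᴾ g) x ⟩
    eval X x + eval (γ · Trᴾ g) x                 ≈⟨ +-cong (eval-X x) (eval-· γ (Trᴾ g) x) ⟩
    x + γ * eval (Trᴾ g) x                        ≈⟨ +-congˡ (*-congˡ (eval-Tr g x)) ⟩
    x + γ * Tr (eval g x)                         ≈⟨ +-congˡ (*-congˡ (+-cong eval-g (^-congˡ q eval-g))) ⟩
    x + γ * Tr (x ^ (q ℕ.+ 3) + x ^ (2 ℕ.* q ℕ.+ 2)) ∎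
    where
    g : Polynomial
    g = X ^ᴾ (q ℕ.+ 3) ⊞ X ^ᴾ (2 ℕ.* q ℕ.+ 2)

    eval-X^ : ∀ n → eval (X ^ᴾ n) x ≈ x ^ n
    eval-X^ n = trans (eval-^ X n x) (^-congˡ n (eval-X x))

    eval-g : eval g x ≈ x ^ (q ℕ.+ 3) + x ^ (2 ℕ.* q ℕ.+ 2)
    eval-g = trans (eval-⊞ (X ^ᴾ (q ℕ.+ 3)) _ x) (+-cong (eval-X^ (q ℕ.+ 3)) (eval-X^ (2 ℕ.* q ℕ.+ 2)))

{-# OPTIONS --safe #-}

-- Write x̄ = x ^ q, N = x x̄ and T = x + x̄. Since Tr (x^(q+3) + x^(2q+2)) = N T², the
-- polynomial acts as x ↦ x + γ N T², and for γ ≠ 0 we exhibit x ≠ y with the same image: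
--   * if γ̄ = −γ: 1 and 1 + 1/(4γ);
--   * if γ̄ ≠ ±γ: z + γ and z − γ with z = 1/((γ + γ̄)² (γ − γ̄));
--   * if γ̄ = γ: u + d + z and u − d + z with ū = u, d̄ = d ≠ 0 and z̄ = −z, where the images
--     agree iff 1 + 16 γ u (u² + d² − z²/2) = 0. Taking u = ±1, one must solve
--     d² − w² = e with z = √2 w, for a suitable e ≠ 0, −1 fixed by the bar. As 8 divides
--     q² − 1, the field contains √2; depending on whether √2 is fixed by the bar, d² − w²
--     is a norm or a product of two arbitrary elements of the subfield, so e is attained.
module Submission where

open import Algebra.Bundles using (CommutativeRing; CommutativeSemiring)
import Algebra.Properties.CommutativeMonoid.Sum as Sum
import Algebra.Solver.Ring
import Algebra.Solver.Ring.AlmostCommutativeRing as ACR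
open import Data.Bool.Base using (if_then_else_)
open import Data.Fin.Base using (Fin; zero; suc; fromℕ; inject₁; punchIn)
open import Data.Fin.Permutation using (Permutation; permutation; _⟨$⟩ʳ_)
import Data.Fin.Properties as Fin
open import Data.Integer.Base as ℤ using (ℤ; +_; -[1+_]; 1ℤ)
import Data.Integer.Properties as ℤ
open import Data.Maybe.Base using (Maybe; just; nothing)
open import Data.Nat.Base as ℕ using (ℕ; zero; suc; z≤n; s≤s; _^_)
open import Data.Nat.Combinatorics using (_C_; nC1≡n; nCn≡1; nCk+nC[k+1]≡[n+1]C[k+1]; k>n⇒nCk≡0)
open import Data.Nat.Divisibility using (_∣_; _∤_; divides; m∣m*n; ∣⇒≤)
open import Data.Nat.Primality using (Prime; euclidsLemma)
import Data.Nat.Properties as ℕ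
open import Data.Nat.Tactic.RingSolver using (solve-∀)
open import Data.Product.Base using (∃; ∃₂; _×_; _,_; proj₁; proj₂)
open import Data.Sum.Base using (_⊎_; inj₁; inj₂)
open import Data.Vec.Functional using (replicate)
open import Function.Base using (_∘_)
open import Function.Bundles using (Inverse; _⇔_; mk⇔)
open import Level using (Level; _⊔_)
open import Relation.Binary.PropositionalEquality as ≡ using (_≡_)
open import Relation.Nullary using (¬_; Dec; yes; no; does; contradiction)
open import Relation.Nullary.Decidable using (map′; ¬?; decidable-stable)
open import Defs

-- A ring solver with integer coefficients.

module IntegerSolver {c ℓ} (R : CommutativeRing c ℓ) where
  open CommutativeRing R
  open import Algebra.Properties.Ring ring
  open import Algebra.Properties.AbelianGroup +-abelianGroup using (⁻¹-∙-comm)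
  open import Algebra.Properties.Semiring.Mult.TCOptimised semiring renaming (_×_ to _·_)
  open import Relation.Binary.Reasoning.Setoid setoid

  -- The optimised multiple adds no trailing zero, so `con 1ℤ` and `con (+ 2)` evaluate
  -- definitionally to `1#` and `1# + 1#`, the form used in the goals.
  fromℤ : ℤ → Carrier
  fromℤ (+ n)      = n · 1#
  fromℤ (-[1+ n ]) = - (suc n · 1#)

  fromℤ-neg : ∀ i → fromℤ (ℤ.- i) ≈ - fromℤ i
  fromℤ-neg (+ zero)   = sym -0#≈0#
  fromℤ-neg (+ suc n)  = refl
  fromℤ-neg (-[1+ n ]) = sym (-‿involutive _)

  cancel-1 : ∀ x y → (x + 1#) - (y + 1#) ≈ x - y
  cancel-1 x y = begin
    (x + 1#) - (y + 1#)         ≈⟨ +-congˡ (⁻¹-∙-comm y 1#) ⟨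
    (x + 1#) + (- y + - 1#)     ≈⟨ +-congˡ (+-comm _ _) ⟩
    (x + 1#) + (- 1# + - y)     ≈⟨ +-assoc _ _ _ ⟩
    x + (1# + (- 1# + - y))     ≈⟨ +-congˡ (+-assoc _ _ _) ⟨
    x + ((1# - 1#) + - y)       ≈⟨ +-congˡ (+-congʳ (-‿inverseʳ 1#)) ⟩
    x + (0# + - y)              ≈⟨ +-congˡ (+-identityˡ _) ⟩
    x - y                       ∎

  ×-suc : ∀ n → suc n · 1# ≈ n · 1# + 1#
  ×-suc n = trans (×-cong (ℕ.+-comm 1 n) refl) (×-homo-+ 1# n 1)

  fromℤ-⊖ : ∀ m n → fromℤ (m ℤ.⊖ n) ≈ m · 1# - n · 1#
  fromℤ-⊖ m       zero    = sym (trans (+-congˡ -0#≈0#) (+-identityʳ _))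
  fromℤ-⊖ zero    (suc n) = sym (+-identityˡ _)
  fromℤ-⊖ (suc m) (suc n) = begin
    fromℤ (suc m ℤ.⊖ suc n)               ≡⟨ ≡.cong fromℤ (ℤ.[1+m]⊖[1+n]≡m⊖n m n) ⟩
    fromℤ (m ℤ.⊖ n)                       ≈⟨ fromℤ-⊖ m n ⟩
    m · 1# - n · 1#                       ≈⟨ cancel-1 _ _ ⟨
    (m · 1# + 1#) - (n · 1# + 1#)         ≈⟨ +-cong (×-suc m) (-‿cong (×-suc n)) ⟨
    suc m · 1# - suc n · 1#               ∎

  fromℤ-+ : ∀ i j → fromℤ (i ℤ.+ j) ≈ fromℤ i + fromℤ j
  fromℤ-+ (+ m)      (+ n)      = ×-homo-+ 1# m n
  fromℤ-+ (+ m)      (-[1+ n ]) = fromℤ-⊖ m (suc n)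
  fromℤ-+ (-[1+ m ]) (+ n)      = trans (fromℤ-⊖ n (suc m)) (+-comm _ _)
  fromℤ-+ (-[1+ m ]) (-[1+ n ]) = begin
    - (suc (suc (m ℕ.+ n)) · 1#)       ≈⟨ -‿cong (×-cong (≡.cong suc (≡.sym (ℕ.+-suc m n))) refl) ⟩
    - ((suc m ℕ.+ suc n) · 1#)         ≈⟨ -‿cong (×-homo-+ 1# (suc m) (suc n)) ⟩
    - (suc m · 1# + suc n · 1#)        ≈⟨ ⁻¹-∙-comm _ _ ⟨
    - (suc m · 1#) + - (suc n · 1#)    ∎

  fromℤ-*ˡ : ∀ m j → fromℤ (+ m ℤ.* j) ≈ m · 1# * fromℤ j
  fromℤ-*ˡ m (+ n)      = trans (reflexive (≡.cong fromℤ (≡.sym (ℤ.pos-* m n)))) (×1-homo-* m n)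
  fromℤ-*ˡ m (-[1+ n ]) = begin
    fromℤ (+ m ℤ.* -[1+ n ])           ≡⟨ ≡.cong fromℤ (≡.sym (ℤ.neg-distribʳ-* (+ m) (+ suc n))) ⟩
    fromℤ (ℤ.- (+ m ℤ.* + suc n))      ≈⟨ fromℤ-neg (+ m ℤ.* + suc n) ⟩
    - fromℤ (+ m ℤ.* + suc n)          ≈⟨ -‿cong (fromℤ-*ˡ m (+ suc n)) ⟩
    - (m · 1# * suc n · 1#)            ≈⟨ -‿distribʳ-* _ _ ⟩
    m · 1# * - (suc n · 1#)            ∎

  fromℤ-* : ∀ i j → fromℤ (i ℤ.* j) ≈ fromℤ i * fromℤ j
  fromℤ-* (+ m)      j = fromℤ-*ˡ m j
  fromℤ-* (-[1+ m ]) j = begin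
    fromℤ (-[1+ m ] ℤ.* j)             ≡⟨ ≡.cong fromℤ (≡.sym (ℤ.neg-distribˡ-* (+ suc m) j)) ⟩
    fromℤ (ℤ.- (+ suc m ℤ.* j))        ≈⟨ fromℤ-neg (+ suc m ℤ.* j) ⟩
    - fromℤ (+ suc m ℤ.* j)            ≈⟨ -‿cong (fromℤ-*ˡ (suc m) j) ⟩
    - (suc m · 1# * fromℤ j)           ≈⟨ -‿distribˡ-* _ _ ⟩
    - (suc m · 1#) * fromℤ j           ∎

  fromℤ-homomorphism : ℤ.+-*-rawRing ACR.-Raw-AlmostCommutative⟶ ACR.fromCommutativeRing R
  fromℤ-homomorphism = record
    { ⟦_⟧    = fromℤ
    ; +-homo = fromℤ-+
    ; *-homo = fromℤ-*
    ; -‿homo = fromℤ-neg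
    ; 0-homo = refl
    ; 1-homo = refl
    }

  -- Distinct integers may coincide in the ring, so inequality in ℤ yields `nothing` rather than a
  -- refutation.
  fromℤ-≟ : ∀ i j → Maybe (fromℤ i ≈ fromℤ j)
  fromℤ-≟ i j with i ℤ.≟ j
  ... | yes i≡j = just (reflexive (≡.cong fromℤ i≡j))
  ... | no  _   = nothing

  open Algebra.Solver.Ring _ _ fromℤ-homomorphism fromℤ-≟ public
    using (solve; _:=_; _:+_; _:*_; _:-_; :-_; con)

-- Binomial coefficients modulo a prime.

[1+k]*[1+n]C[1+k] : ∀ n k → suc k ℕ.* (suc n C suc k) ≡ suc n ℕ.* (n C k)
[1+k]*[1+n]C[1+k] n       zero    = ≡.trans (ℕ.*-identityˡ _) (≡.trans (nC1≡n (suc n)) (≡.sym (ℕ.*-identityʳ _)))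
[1+k]*[1+n]C[1+k] zero    (suc k) = begin
  suc (suc k) ℕ.* (1 C suc (suc k)) ≡⟨ ≡.cong (suc (suc k) ℕ.*_) (k>n⇒nCk≡0 {1} {suc (suc k)} (s≤s (s≤s z≤n))) ⟩
  suc (suc k) ℕ.* 0                 ≡⟨ ℕ.*-zeroʳ (suc (suc k)) ⟩
  0                                 ≡⟨ ≡.cong (1 ℕ.*_) (k>n⇒nCk≡0 {0} {suc k} (s≤s z≤n)) ⟨
  1 ℕ.* (0 C suc k)                 ∎
  where open ≡.≡-Reasoning
-- Pascal's rule splits the coefficient, one copy of the first summand is set aside, the two
-- induction hypotheses apply, and Pascal's rule turns the rest into n + 1 further copies of that
-- summand.
[1+k]*[1+n]C[1+k] (suc n) (suc k) = begin
  suc (suc k) ℕ.* (suc (suc n) C suc (suc k))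
    ≡⟨ ≡.cong (suc (suc k) ℕ.*_) (nCk+nC[k+1]≡[n+1]C[k+1] (suc n) (suc k)) ⟨
  suc (suc k) ℕ.* ((suc n C suc k) ℕ.+ (suc n C suc (suc k)))
    ≡⟨ split k (suc n C suc k) (suc n C suc (suc k)) ⟩
  (suc n C suc k) ℕ.+ (suc k ℕ.* (suc n C suc k) ℕ.+ suc (suc k) ℕ.* (suc n C suc (suc k)))
    ≡⟨ ≡.cong ((suc n C suc k) ℕ.+_) (≡.cong₂ ℕ._+_ ([1+k]*[1+n]C[1+k] n k) ([1+k]*[1+n]C[1+k] n (suc k))) ⟩
  (suc n C suc k) ℕ.+ (suc n ℕ.* (n C k) ℕ.+ suc n ℕ.* (n C suc k))
    ≡⟨ ≡.cong ((suc n C suc k) ℕ.+_) (ℕ.*-distribˡ-+ (suc n) (n C k) (n C suc k)) ⟨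
  (suc n C suc k) ℕ.+ suc n ℕ.* ((n C k) ℕ.+ (n C suc k))
    ≡⟨ ≡.cong (λ m → (suc n C suc k) ℕ.+ suc n ℕ.* m) (nCk+nC[k+1]≡[n+1]C[k+1] n k) ⟩
  suc (suc n) ℕ.* (suc n C suc k)
    ∎
  where
  open ≡.≡-Reasoning
  split : ∀ k a b → suc (suc k) ℕ.* (a ℕ.+ b) ≡ a ℕ.+ (suc k ℕ.* a ℕ.+ suc (suc k) ℕ.* b)
  split = solve-∀

-- By the absorption identity the prime divides `suc k` times the coefficient, and it is too large
-- to divide `suc k`.
prime∣C : ∀ {n k} → Prime (suc n) → k ℕ.< n → suc n ∣ (suc n C suc k)
prime∣C {n} {k} pr k<n
  with euclidsLemma (suc k) (suc n C suc k) pr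
         (≡.subst (suc n ∣_) (≡.sym ([1+k]*[1+n]C[1+k] n k)) (m∣m*n (n C k)))
... | inj₁ p∣1+k = contradiction (∣⇒≤ p∣1+k) (ℕ.<⇒≱ (s≤s k<n))
... | inj₂ p∣C   = p∣C

-- The Frobenius map in characteristic p.

module Frobenius {c ℓ} (S : CommutativeSemiring c ℓ) where
  open CommutativeSemiring S hiding (zero)
  open import Algebra.Properties.Semiring.Mult semiring using (×1-homo-*; ×-assoc-*; ×-congʳ; ×-homo-1) renaming (_×_ to _·_)
  open import Algebra.Properties.Semiring.Sum semiring using (sum-init-last; sum-cong-≋; sum-replicate-zero; sum)
  open import Algebra.Properties.CommutativeSemiring.Exp S using (^-congˡ; ^-assocʳ) renaming (_^_ to _^ᶠ_)
  open import Algebra.Properties.CommutativeSemiring.Binomial S using (theorem; binomialTerm)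
  open import Relation.Binary.Reasoning.Setoid setoid

  multiple-vanishes : ∀ {p m} → p · 1# ≈ 0# → p ∣ m → ∀ x → m · x ≈ 0#
  multiple-vanishes {p} {m} p≈0 (divides k ≡.refl) x = begin
    (k ℕ.* p) · x               ≈⟨ ×-congʳ (k ℕ.* p) (*-identityˡ x) ⟨
    (k ℕ.* p) · (1# * x)        ≈⟨ ×-assoc-* (k ℕ.* p) 1# x ⟨
    (k ℕ.* p) · 1# * x          ≈⟨ *-congʳ (×1-homo-* k p) ⟩
    (k · 1#) * (p · 1#) * x     ≈⟨ *-congʳ (*-congˡ p≈0) ⟩
    (k · 1#) * 0# * x           ≈⟨ *-congʳ (zeroʳ _) ⟩
    0# * x                      ≈⟨ zeroˡ x ⟩
    0#                          ∎

  -- In the binomial expansion every inner coefficient is a multiple of p, so only the two end terms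
  -- survive.
  frobenius : ∀ {p} → Prime p → p · 1# ≈ 0# → ∀ x y → (x + y) ^ᶠ p ≈ x ^ᶠ p + y ^ᶠ p
  frobenius {suc n} pr p≈0 x y = begin
    (x + y) ^ᶠ suc n                                ≈⟨ theorem (suc n) x y ⟩
    term zero + sum (λ i → term (suc i))           ≈⟨ +-cong term-zero (sum-init-last (λ i → term (suc i))) ⟩
    y ^ᶠ suc n + (sum (λ i → term (suc (inject₁ i))) + term (suc (fromℕ n)))
      ≈⟨ +-congˡ (+-cong (trans (sum-cong-≋ inner) (sum-replicate-zero n)) term-last) ⟩
    y ^ᶠ suc n + (0# + x ^ᶠ suc n)                   ≈⟨ +-congˡ (+-identityˡ _) ⟩
    y ^ᶠ suc n + x ^ᶠ suc n                          ≈⟨ +-comm _ _ ⟩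
    x ^ᶠ suc n + y ^ᶠ suc n                          ∎
    where
    term = binomialTerm x y (suc n)

    term-zero : term zero ≈ y ^ᶠ suc n
    term-zero = trans (×-homo-1 _) (*-identityˡ _)

    inner : ∀ i → term (suc (inject₁ i)) ≈ 0#
    inner i rewrite Fin.toℕ-inject₁ i = multiple-vanishes p≈0 (prime∣C pr (Fin.toℕ<n i)) _

    term-last : term (suc (fromℕ n)) ≈ x ^ᶠ suc n
    term-last rewrite Fin.toℕ-fromℕ n | nCn≡1 (suc n) | ℕ.n∸n≡0 n = trans (×-homo-1 _) (*-identityʳ _)

  frobenius-iterate : ∀ {p} → Prime p → p · 1# ≈ 0# → ∀ k x y → (x + y) ^ᶠ (p ^ k) ≈ x ^ᶠ (p ^ k) + y ^ᶠ (p ^ k)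
  frobenius-iterate         pr p≈0 zero    x y = trans (*-identityʳ _) (sym (+-cong (*-identityʳ x) (*-identityʳ y)))
  frobenius-iterate {p} pr p≈0 (suc k) x y = begin
    (x + y) ^ᶠ (p ℕ.* p ^ k)                         ≈⟨ ^-assocʳ (x + y) p (p ^ k) ⟨
    ((x + y) ^ᶠ p) ^ᶠ (p ^ k)                         ≈⟨ ^-congˡ (p ^ k) (frobenius pr p≈0 x y) ⟩
    (x ^ᶠ p + y ^ᶠ p) ^ᶠ (p ^ k)                       ≈⟨ frobenius-iterate pr p≈0 k (x ^ᶠ p) (y ^ᶠ p) ⟩
    (x ^ᶠ p) ^ᶠ (p ^ k) + (y ^ᶠ p) ^ᶠ (p ^ k)         ≈⟨ +-cong (^-assocʳ x p (p ^ k)) (^-assocʳ y p (p ^ k)) ⟩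
    x ^ᶠ (p ℕ.* p ^ k) + y ^ᶠ (p ℕ.* p ^ k)         ∎

-- Finite fields: roots of polynomials, x ^ n = x, and the characteristic.

module FiniteFields {c ℓ : Level} {n : ℕ} (F : FiniteField c ℓ n) where
  open FiniteField F hiding (zero)
  open import Algebra.Properties.CommutativeSemiring.Exp commutativeSemiring using (^-congˡ) renaming (_^_ to _^ᶠ_)
  open import Algebra.Properties.Ring ring using (x∙y⁻¹≈ε⇒x≈y; +-identityʳ-unique)
  open import Algebra.Properties.Semiring.Mult semiring using (×1-homo-*) renaming (_×_ to _·_)
  open import Relation.Binary.Reasoning.Setoid setoid
  open IntegerSolver commutativeRing
  open Inverse cardinality using (to; from; to-cong; strictlyInverseˡ; strictlyInverseʳ)
  module Π = Sum *-commutativeMonoid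
  module Σ = Sum +-commutativeMonoid

  to-injective : ∀ {x y} → to x ≡ to y → x ≈ y
  to-injective {x} {y} eq = begin
    x           ≈⟨ strictlyInverseʳ x ⟨
    from (to x) ≡⟨ ≡.cong from eq ⟩
    from (to y) ≈⟨ strictlyInverseʳ y ⟩
    y           ∎

  from-injective : ∀ {i j} → from i ≈ from j → i ≡ j
  from-injective {i} {j} eq = ≡.trans (≡.sym (strictlyInverseˡ i)) (≡.trans (to-cong eq) (strictlyInverseˡ j))

  infix 4 _≟_
  _≟_ : ∀ x y → Dec (x ≈ y)
  x ≟ y = map′ to-injective to-cong (to x Fin.≟ to y)

  *-cancelˡ-nonzero : ∀ {a x y} → a ≉ 0# → a * x ≈ a * y → x ≈ y
  *-cancelˡ-nonzero {a} {x} {y} a≉0 ax≈ay with b , ab≈1 ← inverse a a≉0 = begin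
    x             ≈⟨ *-identityˡ x ⟨
    1# * x        ≈⟨ *-congʳ ab≈1 ⟨
    a * b * x     ≈⟨ shuffle a b x ⟩
    b * (a * x)   ≈⟨ *-congˡ ax≈ay ⟩
    b * (a * y)   ≈⟨ shuffle a b y ⟨
    a * b * y     ≈⟨ *-congʳ ab≈1 ⟩
    1# * y        ≈⟨ *-identityˡ y ⟩
    y             ∎
    where
    shuffle : ∀ a b x → a * b * x ≈ b * (a * x)
    shuffle = solve 3 (λ a b x → a :* b :* x := b :* (a :* x)) refl

  x*y≈0⇒y≈0 : ∀ {x y} → x ≉ 0# → x * y ≈ 0# → y ≈ 0#
  x*y≈0⇒y≈0 {x} x≉0 xy≈0 = *-cancelˡ-nonzero x≉0 (trans xy≈0 (sym (zeroʳ x)))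

  x*y≉0 : ∀ {x y} → x ≉ 0# → y ≉ 0# → x * y ≉ 0#
  x*y≉0 x≉0 y≉0 xy≈0 = y≉0 (x*y≈0⇒y≈0 x≉0 xy≈0)

  x*y≈1⇒y≉0 : ∀ {x y} → x * y ≈ 1# → y ≉ 0#
  x*y≈1⇒y≉0 {x} xy≈1 y≈0 = 1≉0 (trans (sym xy≈1) (trans (*-congˡ y≈0) (zeroʳ x)))

  x^k≈0⇒x≈0 : ∀ {x} k → x ^ᶠ k ≈ 0# → x ≈ 0#
  x^k≈0⇒x≈0     zero    1≈0 = contradiction 1≈0 1≉0
  x^k≈0⇒x≈0 {x} (suc k) eq with x ≟ 0#
  ... | yes x≈0 = x≈0
  ... | no  x≉0 = x^k≈0⇒x≈0 k (x*y≈0⇒y≈0 x≉0 eq)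

  -- Monic k f says that f is the function of a monic polynomial of degree k in Horner form.
  data Monic : ℕ → (Carrier → Carrier) → Set (c ⊔ ℓ) where
    one    : ∀ {f} → (∀ x → f x ≈ 1#) → Monic zero f
    horner : ∀ {k f g} a → Monic k g → (∀ x → f x ≈ x * g x + a) → Monic (suc k) f

  monic-shift : ∀ {k f} j → Monic k f → Monic (j ℕ.+ k) (λ x → x ^ᶠ j * f x)
  monic-shift {_} {f} zero (one f≈1)          = one (λ x → trans (*-identityˡ _) (f≈1 x))
  monic-shift zero (horner a g f≈) = horner a g (λ x → trans (*-identityˡ _) (f≈ x))
  monic-shift {_} {f} (suc j) mf = horner 0# (monic-shift j mf) λ x →
    trans (*-assoc _ _ _) (sym (+-identityʳ _))

  monic-^ : ∀ k → Monic k (_^ᶠ k)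
  monic-^ zero    = one (λ _ → refl)
  monic-^ (suc k) = horner 0# (monic-^ k) (λ _ → sym (+-identityʳ _))

  monic-+ : ∀ {k f} a → Monic (suc k) f → Monic (suc k) (λ x → f x + a)
  monic-+ a (horner b g f≈) = horner (b + a) g (λ x → trans (+-congʳ (f≈ x)) (+-assoc _ _ _))

  -- Synthetic division in Horner form: if h is the quotient of g by x - r, then x h + g r is the
  -- quotient of x g + a, and the remainder is the value at r.
  monic-quotient : ∀ {k f} → Monic (suc k) f → ∀ r → ∃ λ g → Monic k g × (∀ x → f x ≈ (x - r) * g x + f r)
  monic-quotient {f = f} (horner {g = g} a (one g≈1) f≈) r = (λ _ → 1#) , one (λ _ → refl) , λ x → begin
    f x                            ≈⟨ f≈ x ⟩
    x * g x + a                    ≈⟨ +-congʳ (*-congˡ (g≈1 x)) ⟩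
    x * 1# + a                     ≈⟨ solve 3 (λ x r a → x :* con 1ℤ :+ a := (x :- r) :* con 1ℤ :+ (r :* con 1ℤ :+ a)) refl x r a ⟩
    (x - r) * 1# + (r * 1# + a)    ≈⟨ +-congˡ (trans (f≈ r) (+-congʳ (*-congˡ (g≈1 r)))) ⟨
    (x - r) * 1# + f r             ∎
  monic-quotient {f = f} (horner {g = g} a mg@(horner _ _ _) f≈) r with monic-quotient mg r
  ... | h , mh , g≈ = (λ x → x * h x + g r) , horner (g r) mh (λ _ → refl) , λ x → begin
    f x                                          ≈⟨ f≈ x ⟩
    x * g x + a                                  ≈⟨ +-congʳ (*-congˡ (g≈ x)) ⟩
    x * ((x - r) * h x + g r) + a
      ≈⟨ solve 5 (λ x r a u v → x :* ((x :- r) :* u :+ v) :+ a := (x :- r) :* (x :* u :+ v) :+ (r :* v :+ a)) refl x r a (h x) (g r) ⟩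
    (x - r) * (x * h x + g r) + (r * g r + a)    ≈⟨ +-congˡ (f≈ r) ⟨
    (x - r) * (x * h x + g r) + f r              ∎

  -- Division by x minus the first root leaves a quotient of smaller degree that still vanishes at
  -- the other roots, since they differ from the first.
  monic-roots : ∀ {k m f} → Monic k f → (ρ : Fin m → Carrier) →
    (∀ {i j} → ρ i ≈ ρ j → i ≡ j) → (∀ i → f (ρ i) ≈ 0#) → m ℕ.≤ k
  monic-roots {m = zero}  _ ρ ρ-inj root = z≤n
  monic-roots {m = suc m} (one f≈1) ρ ρ-inj root = contradiction (trans (sym (f≈1 _)) (root zero)) 1≉0
  monic-roots {m = suc m} {f} mf@(horner _ _ _) ρ ρ-inj root with monic-quotient mf (ρ zero)
  ... | g , mg , f≈ = s≤s (monic-roots mg (ρ ∘ suc) (λ eq → Fin.suc-injective (ρ-inj eq)) λ i →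
    x*y≈0⇒y≈0
      (λ eq → contradiction (ρ-inj (x∙y⁻¹≈ε⇒x≈y _ _ eq)) λ ())
      (begin
        (ρ (suc i) - ρ zero) * g (ρ (suc i))               ≈⟨ +-identityʳ _ ⟨
        (ρ (suc i) - ρ zero) * g (ρ (suc i)) + 0#          ≈⟨ +-congˡ (root zero) ⟨
        (ρ (suc i) - ρ zero) * g (ρ (suc i)) + f (ρ zero)  ≈⟨ f≈ (ρ (suc i)) ⟨
        f (ρ (suc i))                                      ≈⟨ root (suc i) ⟩
        0#                                                 ∎))

  -- A search through the finite field makes the witness explicit; if it failed, `from` would
  -- enumerate n distinct roots.
  monic-nonroot : ∀ {k f} → Monic k f → k ℕ.< n → ∃ λ x → f x ≉ 0#
  monic-nonroot {f = f} mf k<n with Fin.any? (λ i → ¬? (f (from i) ≟ 0#))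
  ... | yes (i , fi≉0) = from i , fi≉0
  ... | no  none       = contradiction
    (monic-roots mf from from-injective (λ i → decidable-stable (f (from i) ≟ 0#) (λ fi≉0 → none (i , fi≉0))))
    (ℕ.<⇒≱ k<n)

  -- Sums and products over the field are indexed by `Fin n`, so a bijection of the field has to be
  -- carried over to the indices.
  conjugate : (φ ψ : Carrier → Carrier) → (∀ {x y} → x ≈ y → φ x ≈ φ y) → (∀ {x y} → x ≈ y → ψ x ≈ ψ y) →
    (∀ x → φ (ψ x) ≈ x) → (∀ x → ψ (φ x) ≈ x) → Permutation n n
  conjugate φ ψ φ-cong ψ-cong φψ ψφ = permutation (to ∘ φ ∘ from) (to ∘ ψ ∘ from)
    (λ i → ≡.trans (to-cong (trans (φ-cong (strictlyInverseʳ _)) (φψ (from i)))) (strictlyInverseˡ i))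
    (λ i → ≡.trans (to-cong (trans (ψ-cong (strictlyInverseʳ _)) (ψφ (from i)))) (strictlyInverseˡ i))

  -- Translation by 1 permutes the field, so it leaves the sum of all elements unchanged.
  n·1≈0 : n · 1# ≈ 0#
  n·1≈0 = +-identityʳ-unique (Σ.sum from) (n · 1#) (begin
    Σ.sum from + n · 1#                      ≈⟨ +-congˡ (Σ.sum-replicate n) ⟨
    Σ.sum from + Σ.sum (replicate n 1#)      ≈⟨ Σ.∑-distrib-+ from (replicate n 1#) ⟨
    Σ.sum (λ i → from i + 1#)                ≈⟨ Σ.sum-cong-≋ {n} (λ i → strictlyInverseʳ (from i + 1#)) ⟨
    Σ.sum (λ i → from (π ⟨$⟩ʳ i))            ≈⟨ Σ.sum-permute from π ⟨
    Σ.sum from                               ∎)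
    where
    π = conjugate (_+ 1#) (_- 1#) +-congʳ +-congʳ
      (solve 1 (λ x → (x :- con 1ℤ) :+ con 1ℤ := x) refl)
      (solve 1 (λ x → (x :+ con 1ℤ) :- con 1ℤ := x) refl)

  -- With i₀ the index of zero, a product over the nonzero elements becomes a product over all
  -- indices, to which invariance under permutations applies.
  oneAt : ∀ {m} → Fin m → (Fin m → Carrier) → Fin m → Carrier
  oneAt i₀ v i = if does (i Fin.≟ i₀) then 1# else v i

  -- The factor in front makes up for the entry replaced by 1, so the exponent is m and not m - 1.
  oneAt-product : ∀ {m} (i₀ : Fin m) a → a * Π.sum (oneAt i₀ (replicate m a)) ≈ a ^ᶠ m
  oneAt-product {suc m} i₀ a = *-congˡ (begin
    Π.sum s                       ≈⟨ Π.sum-remove {i = i₀} s ⟩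
    s i₀ * Π.sum (λ i → s (punchIn i₀ i))  ≈⟨ *-cong s-i₀ (Π.sum-cong-≋ {m} s-rest) ⟩
    1# * Π.sum (replicate m a)    ≈⟨ *-identityˡ _ ⟩
    Π.sum (replicate m a)         ≈⟨ Π.sum-replicate m ⟩
    a ^ᶠ m                         ∎)
    where
    s = oneAt i₀ (replicate (suc m) a)

    s-i₀ : s i₀ ≈ 1#
    s-i₀ with i₀ Fin.≟ i₀
    ... | yes _     = refl
    ... | no  i₀≢i₀ = contradiction ≡.refl i₀≢i₀

    s-rest : ∀ i → s (punchIn i₀ i) ≈ a
    s-rest i with punchIn i₀ i Fin.≟ i₀
    ... | yes eq = contradiction eq (Fin.punchInᵢ≢i i₀ i)
    ... | no  _  = refl

  product≉0 : ∀ {m} (v : Fin m → Carrier) → (∀ i → v i ≉ 0#) → Π.sum v ≉ 0#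
  product≉0 {zero}  v v≉0 = 1≉0
  product≉0 {suc m} v v≉0 = x*y≉0 (v≉0 zero) (product≉0 (v ∘ suc) (v≉0 ∘ suc))

  -- Multiplication by a permutes the nonzero elements, so it leaves their product unchanged.
  x^n≈x-nonzero : ∀ {a} → a ≉ 0# → a ^ᶠ n ≈ a
  x^n≈x-nonzero {a} a≉0 with b , ab≈1 ← inverse a a≉0 = begin
    a ^ᶠ n          ≈⟨ oneAt-product i₀ a ⟨
    a * Π.sum s    ≈⟨ *-congˡ Πs≈1 ⟩
    a * 1#         ≈⟨ *-identityʳ a ⟩
    a              ∎
    where
    i₀ = to 0#
    s = oneAt i₀ (replicate n a)
    t = oneAt i₀ from

    undo : ∀ {u v} → u * v ≈ 1# → ∀ x → u * (v * x) ≈ x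
    undo uv≈1 x = trans (sym (*-assoc _ _ x)) (trans (*-congʳ uv≈1) (*-identityˡ x))

    π = conjugate (a *_) (b *_) *-congˡ *-congˡ (undo ab≈1) (undo (trans (*-comm b a) ab≈1))

    -- At the index of zero all three entries are 1; elsewhere the permuted entry is a times the old
    -- one. The mixed cases fail because a x = 0 exactly when x = 0.
    t∘π≈s*t : ∀ i → t (π ⟨$⟩ʳ i) ≈ s i * t i
    t∘π≈s*t i with i Fin.≟ i₀ | (π ⟨$⟩ʳ i) Fin.≟ i₀
    ... | yes _      | yes _   = sym (*-identityˡ 1#)
    ... | no  _      | no  _   = strictlyInverseʳ _
    ... | yes ≡.refl | no  π≢i₀ = contradiction (to-cong (trans (*-congˡ (strictlyInverseʳ 0#)) (zeroʳ a))) π≢i₀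
    ... | no  i≢i₀   | yes π≡i₀ = contradiction
      (≡.trans (≡.sym (strictlyInverseˡ i)) (to-cong (x*y≈0⇒y≈0 a≉0 (to-injective π≡i₀)))) i≢i₀

    t≉0 : ∀ i → t i ≉ 0#
    t≉0 i with i Fin.≟ i₀
    ... | yes _    = 1≉0
    ... | no  i≢i₀ = λ eq → i≢i₀ (≡.trans (≡.sym (strictlyInverseˡ i)) (to-cong eq))

    Πs≈1 : Π.sum s ≈ 1#
    Πs≈1 = *-cancelˡ-nonzero (product≉0 t t≉0) (begin
      Π.sum t * Π.sum s              ≈⟨ *-comm _ _ ⟩
      Π.sum s * Π.sum t              ≈⟨ Π.∑-distrib-+ s t ⟨
      Π.sum (λ i → s i * t i)        ≈⟨ Π.sum-cong-≋ {n} t∘π≈s*t ⟨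
      Π.sum (λ i → t (π ⟨$⟩ʳ i))     ≈⟨ Π.sum-permute t π ⟨
      Π.sum t                        ≈⟨ *-identityʳ _ ⟨
      Π.sum t * 1#                   ∎)

  -- The element of `Fin m` witnesses that m is positive; the zeroth power would be 1.
  0^m≈0 : ∀ {m} → Fin m → 0# ^ᶠ m ≈ 0#
  0^m≈0 {suc m} _ = zeroˡ _

  x^n≈x : ∀ x → x ^ᶠ n ≈ x
  x^n≈x x with x ≟ 0#
  ... | no  x≉0 = x^n≈x-nonzero x≉0
  ... | yes x≈0 = trans (^-congˡ n x≈0) (trans (0^m≈0 (to 0#)) (sym x≈0))

  x^[n-1]≈1 : ∀ {k x} → n ≡ suc k → x ≉ 0# → x ^ᶠ k ≈ 1#
  x^[n-1]≈1 {k} {x} n≡1+k x≉0 = *-cancelˡ-nonzero x≉0 (begin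
    x ^ᶠ suc k   ≡⟨ ≡.cong (x ^ᶠ_) n≡1+k ⟨
    x ^ᶠ n       ≈⟨ x^n≈x x ⟩
    x           ≈⟨ *-identityʳ x ⟨
    x * 1#      ∎)

  -- In a field p · 1 vanishes as soon as its k-th power does, and that power is n · 1.
  characteristic : ∀ {p k} → n ≡ p ^ k → p · 1# ≈ 0#
  characteristic {p} {k} n≡p^k = x^k≈0⇒x≈0 k (begin
    (p · 1#) ^ᶠ k      ≈⟨ power k ⟩
    (p ^ k) · 1#    ≡⟨ ≡.cong (_· 1#) n≡p^k ⟨
    n · 1#            ≈⟨ n·1≈0 ⟩
    0#                ∎)
    where
    power : ∀ k → (p · 1#) ^ᶠ k ≈ (p ^ k) · 1#
    power zero    = sym (+-identityʳ 1#)
    power (suc k) = trans (*-congˡ (power k)) (sym (×1-homo-* p (p ^ k)))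

-- Polynomial identities behind the collisions.

module ValueIdentities {c ℓ : Level} (R : CommutativeRing c ℓ) where
  open CommutativeRing R
  open IntegerSolver R

  -- The conjugate of x enters as an independent variable x′, so equality of images reduces to
  -- identities valid in every commutative ring.
  value : Carrier → Carrier → Carrier → Carrier
  value γ x x′ = x + γ * (x * x′ * ((x + x′) * (x + x′)))

  value-cong : ∀ γ {x x′ x″} → x′ ≈ x″ → value γ x x′ ≈ value γ x x″
  value-cong γ eq = +-congˡ (*-congˡ (*-cong (*-congˡ eq) (*-cong (+-congˡ eq) (+-congˡ eq))))

  -- The product of twos lets nonvanishing and the behaviour under conjugation be checked factor by
  -- factor.
  16· : Carrier → Carrier
  16· γ = (1# + 1#) * (1# + 1#) * ((1# + 1#) * (1# + 1#)) * γ

  -x*-y≈x*y′ : ∀ a x y → a * - x * - y ≈ a * x * y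
  -x*-y≈x*y′ = solve 3 (λ a x y → a :* :- x :* :- y := a :* x :* y) refl

  -- Conjugation exchanges γ and γ′, which negates only the factor γ - γ′; hence the inverse z of
  -- the product is sent to -z.
  swap-conjugates : ∀ γ γ′ z →
    (γ′ + γ) * (γ′ + γ) * (γ′ + - γ) * - z ≈ (γ + γ′) * (γ + γ′) * (γ - γ′) * z
  swap-conjugates = solve 3 (λ γ γ′ z →
    (γ′ :+ γ) :* (γ′ :+ γ) :* (γ′ :+ :- γ) :* :- z := (γ :+ γ′) :* (γ :+ γ′) :* (γ :- γ′) :* z) refl

  -- Each identity below ends in multiples of the relations that define its parameters.
  value-1+t : ∀ γ t →
    value γ (1# + t) (1# + - t) ≈ value γ 1# 1# + - t * ((1# + 1#) * (1# + 1#) * γ * t - 1#)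
  value-1+t = solve 2 (λ γ t →
    let value = λ x x′ → x :+ γ :* (x :* x′ :* ((x :+ x′) :* (x :+ x′))) in
    value (con 1ℤ :+ t) (con 1ℤ :+ :- t)
      := value (con 1ℤ) (con 1ℤ) :+ :- t :* (con (+ 2) :* con (+ 2) :* γ :* t :- con 1ℤ)) refl

  value-z±γ : ∀ γ γ′ z →
    value γ (z + γ) (- z + γ′) ≈
    value γ (z + - γ) (- z + - γ′) + - ((1# + 1#) * γ) * ((γ + γ′) * (γ + γ′) * (γ - γ′) * z - 1#)
  value-z±γ = solve 3 (λ γ γ′ z →
    let value = λ x x′ → x :+ γ :* (x :* x′ :* ((x :+ x′) :* (x :+ x′))) in
    value (z :+ γ) (:- z :+ γ′)
      := value (z :+ :- γ) (:- z :+ :- γ′)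
         :+ :- (con (+ 2) :* γ) :* ((γ :+ γ′) :* (γ :+ γ′) :* (γ :- γ′) :* z :- con 1ℤ)) refl

  value-v+z : ∀ γ v z → value γ (v + z) (v + - z) ≈ (v + z) + (1# + 1#) * (1# + 1#) * γ * (v * v) * (v * v - z * z)
  value-v+z = solve 3 (λ γ v z →
    let value = λ x x′ → x :+ γ :* (x :* x′ :* ((x :+ x′) :* (x :+ x′))) in
    value (v :+ z) (v :+ :- z)
      := (v :+ z) :+ con (+ 2) :* con (+ 2) :* γ :* (v :* v) :* (v :* v :- z :* z)) refl

  2[d²+e]-relation : ∀ m w d e → (m * w) * (m * w) ≈
    (1# + 1#) * (d * d - e) + (w * w) * (m * m - (1# + 1#)) + - (1# + 1#) * (d * d - (w * w + e))
  2[d²+e]-relation = solve 4 (λ m w d e → (m :* w) :* (m :* w) :=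
    con (+ 2) :* (d :* d :- e) :+ (w :* w) :* (m :* m :- con (+ 2)) :+ :- con (+ 2) :* (d :* d :- (w :* w :+ e))) refl

  -- The nonlinear term of `value-v+z` with s in place of z * z, ready for substituting the
  -- prescribed square.
  splitValue : Carrier → Carrier → Carrier → Carrier
  splitValue γ s v = (1# + 1#) * (1# + 1#) * γ * (v * v) * (v * v - s)

  split-difference : ∀ γ u s d z →
    let z² = (1# + 1#) * (d * d - - (1# + u * s)) in
    (u + d + z) + splitValue γ z² (u + d) ≈
    (u + - d + z) + splitValue γ z² (u + - d)
      + (1# + 1#) * d * (16· γ * u - 16· γ * s) * (u * u - 1#) + - ((1# + 1#) * d) * (16· γ * s - 1#)
  split-difference = solve 5 (λ γ u s d z →
    let 16γ = con (+ 2) :* con (+ 2) :* (con (+ 2) :* con (+ 2)) :* γ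
        z² = con (+ 2) :* (d :* d :- :- (con 1ℤ :+ u :* s))
        split = λ v → con (+ 2) :* con (+ 2) :* γ :* (v :* v) :* (v :* v :- z²) in
    (u :+ d :+ z) :+ split (u :+ d)
      := (u :+ :- d :+ z) :+ split (u :+ :- d)
         :+ con (+ 2) :* d :* (16γ :* u :- 16γ :* s) :* (u :* u :- con 1ℤ) :+ :- (con (+ 2) :* d) :* (16γ :* s :- con 1ℤ)) refl

-- Collisions from an abstract conjugation with surjective norm and a square root of 2.

record ConjugationWith√2 {c ℓ : Level} {n : ℕ} (F : FiniteField c ℓ n) : Set (c ⊔ ℓ) where
  open FiniteField F
  field
    2≉0             : 1# + 1# ≉ 0#
    √2              : Carrier
    √2-square       : √2 * √2 ≈ 1# + 1#
    bar             : Carrier → Carrier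
    bar-cong        : ∀ {x y} → x ≈ y → bar x ≈ bar y
    bar-+           : ∀ x y → bar (x + y) ≈ bar x + bar y
    bar-*           : ∀ x y → bar (x * y) ≈ bar x * bar y
    bar-involutive  : ∀ x → bar (bar x) ≈ x
    norm-surjective : ∀ e → bar e ≈ e → e ≉ 0# → ∃ λ y → y * bar y ≈ e

module Collisions {c ℓ : Level} {n : ℕ} (F : FiniteField c ℓ n) (conjugation : ConjugationWith√2 F) where
  open FiniteField F
  open ConjugationWith√2 conjugation
  open FiniteFields F
  open import Algebra.Properties.Ring ring using (x∙y⁻¹≈ε⇒x≈y; x≈y⇒x∙y⁻¹≈ε; +-identityʳ-unique; +-inverseʳ-unique; -0#≈0#; -‿involutive)
  open import Relation.Binary.Reasoning.Setoid setoid
  open IntegerSolver commutativeRing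
  open ValueIdentities commutativeRing

  -- Lets the ring solver work modulo a relation u = v: it only has to confirm that both sides
  -- differ by a given multiple of u - v.
  by-relation : ∀ {s t u v} w → u ≈ v → s ≈ t + w * (u - v) → s ≈ t
  by-relation {s} {t} {u} {v} w u≈v eq = begin
    s                 ≈⟨ eq ⟩
    t + w * (u - v)   ≈⟨ +-congˡ (*-congˡ (x≈y⇒x∙y⁻¹≈ε u≈v)) ⟩
    t + w * 0#        ≈⟨ +-congˡ (zeroʳ w) ⟩
    t + 0#            ≈⟨ +-identityʳ t ⟩
    t                 ∎

  -x≉0 : ∀ {x} → x ≉ 0# → - x ≉ 0#
  -x≉0 {x} x≉0 -x≈0 = x≉0 (trans (sym (-‿involutive x)) (trans (-‿cong -x≈0) -0#≈0#))

  -- By involutivity 1 is itself a value of `bar`, and `bar 1#` acts as a unit on all such values.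
  bar-1 : bar 1# ≈ 1#
  bar-1 = begin
    bar 1#                 ≈⟨ *-identityˡ _ ⟨
    1# * bar 1#            ≈⟨ *-congʳ (bar-involutive 1#) ⟨
    bar (bar 1#) * bar 1#  ≈⟨ bar-* _ _ ⟨
    bar (bar 1# * 1#)      ≈⟨ bar-cong (*-identityʳ _) ⟩
    bar (bar 1#)           ≈⟨ bar-involutive 1# ⟩
    1#                     ∎

  bar-0 : bar 0# ≈ 0#
  bar-0 = +-identityʳ-unique (bar 0#) (bar 0#) (trans (sym (bar-+ 0# 0#)) (bar-cong (+-identityʳ 0#)))

  bar-neg : ∀ x → bar (- x) ≈ - bar x
  bar-neg x = +-inverseʳ-unique (bar x) (bar (- x))
    (trans (sym (bar-+ x (- x))) (trans (bar-cong (-‿inverseʳ x)) bar-0))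

  bar-2 : bar (1# + 1#) ≈ 1# + 1#
  bar-2 = trans (bar-+ 1# 1#) (+-cong bar-1 bar-1)

  infixl 6 _⟨+⟩_
  infixl 7 _⟨*⟩_

  -- These combinators mirror the shape of a term, so its conjugate is assembled from the conjugates
  -- of its atoms.
  _⟨+⟩_ : ∀ {x y x′ y′} → bar x ≈ x′ → bar y ≈ y′ → bar (x + y) ≈ x′ + y′
  p ⟨+⟩ r = trans (bar-+ _ _) (+-cong p r)

  _⟨*⟩_ : ∀ {x y x′ y′} → bar x ≈ x′ → bar y ≈ y′ → bar (x * y) ≈ x′ * y′
  p ⟨*⟩ r = trans (bar-* _ _) (*-cong p r)

  ⟨-⟩_ : ∀ {x x′} → bar x ≈ x′ → bar (- x) ≈ - x′
  ⟨-⟩ p = trans (bar-neg _) (-‿cong p)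

  -- Both `bar y` and `y′` are inverses of `x′`, and inverses are unique.
  bar-inverse : ∀ {x x′ y y′} → x * y ≈ 1# → x′ * y′ ≈ 1# → bar x ≈ x′ → bar y ≈ y′
  bar-inverse {x} {x′} {y} {y′} xy≈1 x′y′≈1 x̄≈x′ = *-cancelˡ-nonzero (x*y≈1⇒y≉0 (trans (*-comm y′ x′) x′y′≈1)) (begin
    x′ * bar y     ≈⟨ *-congʳ x̄≈x′ ⟨
    bar x * bar y  ≈⟨ bar-* x y ⟨
    bar (x * y)    ≈⟨ bar-cong xy≈1 ⟩
    bar 1#         ≈⟨ bar-1 ⟩
    1#             ≈⟨ x′y′≈1 ⟨
    x′ * y′        ∎)

  -- The conjugate squares to 2 again, and in a field this leaves only the two signs.
  bar-√2 : bar √2 ≈ √2 ⊎ bar √2 ≈ - √2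
  bar-√2 with bar √2 - √2 ≟ 0#
  ... | yes eq = inj₁ (x∙y⁻¹≈ε⇒x≈y _ _ eq)
  ... | no  ne = inj₂ (x∙y⁻¹≈ε⇒x≈y _ _ (x*y≈0⇒y≈0 ne (begin
    (bar √2 - √2) * (bar √2 - - √2)   ≈⟨ solve 2 (λ u v → (u :- v) :* (u :- :- v) := u :* u :- v :* v) refl (bar √2) √2 ⟩
    bar √2 * bar √2 - √2 * √2         ≈⟨ x≈y⇒x∙y⁻¹≈ε (trans (sym (bar-* √2 √2)) (trans (bar-cong √2-square) (trans bar-2 (sym √2-square)))) ⟩
    0#                                ∎)))

  ½-with-inverse : ∃ λ h → (1# + 1#) * h ≈ 1#
  ½-with-inverse = inverse (1# + 1#) 2≉0

  ½ : Carrier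
  ½ = proj₁ ½-with-inverse

  2*½≈1 : (1# + 1#) * ½ ≈ 1#
  2*½≈1 = proj₂ ½-with-inverse

  bar-½ : bar ½ ≈ ½
  bar-½ = bar-inverse 2*½≈1 2*½≈1 bar-2

  ½≉0 : ½ ≉ 0#
  ½≉0 = x*y≈1⇒y≉0 2*½≈1

  -- If √2 is not fixed by bar then √2 w has trace zero for w fixed by bar, and
  -- d² − w² = (d − w)(d + w) takes every value; if it is fixed, then w runs over
  -- the trace-zero elements and d² − w² is the norm of d + w.
  twisted-norm : ∀ e → bar e ≈ e → e ≉ 0# → 1# + e ≉ 0# →
    ∃ λ d → ∃ λ w → bar d ≈ d × d ≉ 0# × bar (√2 * w) ≈ - (√2 * w) × d * d ≈ w * w + e
  twisted-norm e ē≈e e≉0 1+e≉0 with bar-√2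
  -- Chosen so that d + w = 1 and d - w = e.
  ... | inj₂ odd = ½ * (1# + e) , ½ * (1# - e) , bar-½ ⟨*⟩ (bar-1 ⟨+⟩ ē≈e) , x*y≉0 ½≉0 1+e≉0
      , trans (odd ⟨*⟩ (bar-½ ⟨*⟩ (bar-1 ⟨+⟩ (⟨-⟩ ē≈e)))) (solve 2 (λ u v → :- u :* v := :- (u :* v)) refl √2 _)
      , by-relation (e * ((1# + 1#) * ½ + 1#)) 2*½≈1
          (solve 2 (λ h e → (h :* (con 1ℤ :+ e)) :* (h :* (con 1ℤ :+ e))
              := ((h :* (con 1ℤ :- e)) :* (h :* (con 1ℤ :- e)) :+ e)
                 :+ e :* (con (+ 2) :* h :+ con 1ℤ) :* (con (+ 2) :* h :- con 1ℤ)) refl ½ e)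
  ... | inj₁ even with norm-surjective e ē≈e e≉0
  ...   | y , yȳ≈e with y + bar y ≟ 0#
  -- The parts of y that `bar` fixes and negates: d + w = y and d - w = `bar y`.
  ...     | no Ty≉0 = ½ * (y + bar y) , ½ * (y - bar y)
      , trans (bar-½ ⟨*⟩ (refl ⟨+⟩ bar-involutive y)) (*-congˡ (+-comm _ _)) , x*y≉0 ½≉0 Ty≉0
      , trans (even ⟨*⟩ (bar-½ ⟨*⟩ (refl ⟨+⟩ (⟨-⟩ bar-involutive y))))
          (solve 4 (λ m h y y′ → m :* (h :* (y′ :- y)) := :- (m :* (h :* (y :- y′)))) refl √2 ½ y (bar y))
      , by-relation 1# yȳ≈e (by-relation (y * bar y * ((1# + 1#) * ½ + 1#)) 2*½≈1
          (solve 4 (λ h e y y′ → (h :* (y :+ y′)) :* (h :* (y :+ y′))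
              := ((h :* (y :- y′)) :* (h :* (y :- y′)) :+ e) :+ con 1ℤ :* (y :* y′ :- e)
                 :+ y :* y′ :* (con (+ 2) :* h :+ con 1ℤ) :* (con (+ 2) :* h :- con 1ℤ)) refl ½ e y (bar y)))
  ...     | yes Ty≈0 with inverse (1# + e) 1+e≉0
  -- Splitting y would now give d = 0, so y is first multiplied by (1 - y) / (1 + y), which has norm
  -- 1 because `bar y` is -y. As y² = -e, the product is d + w for the d and w given here.
  ...       | k , [1+e]k≈1 = (1# + 1#) * e * k , y * (1# - e) * k
      , bar-2 ⟨*⟩ ē≈e ⟨*⟩ bar-k , x*y≉0 (x*y≉0 2≉0 e≉0) (x*y≈1⇒y≉0 [1+e]k≈1)
      , trans (even ⟨*⟩ (ȳ≈-y ⟨*⟩ (bar-1 ⟨+⟩ (⟨-⟩ ē≈e)) ⟨*⟩ bar-k))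
          (solve 4 (λ m y e k → m :* (:- y :* e :* k) := :- (m :* (y :* e :* k))) refl √2 y (1# - e) k)
      , by-relation ((1# - e) * (1# - e) * k * k) (trans (sym (*-congˡ ȳ≈-y)) yȳ≈e)
          (by-relation (e * ((1# + e) * k + 1#)) [1+e]k≈1
          (solve 3 (λ e k y → (con (+ 2) :* e :* k) :* (con (+ 2) :* e :* k)
              := ((y :* (con 1ℤ :- e) :* k) :* (y :* (con 1ℤ :- e) :* k) :+ e)
                 :+ (con 1ℤ :- e) :* (con 1ℤ :- e) :* k :* k :* (y :* :- y :- e)
                 :+ e :* ((con 1ℤ :+ e) :* k :+ con 1ℤ) :* ((con 1ℤ :+ e) :* k :- con 1ℤ)) refl e k y))
      where
      bar-k : bar k ≈ k
      bar-k = bar-inverse [1+e]k≈1 [1+e]k≈1 (bar-1 ⟨+⟩ ē≈e)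
      ȳ≈-y : bar y ≈ - y
      ȳ≈-y = +-inverseʳ-unique y (bar y) Ty≈0

  map-γ : Carrier → Carrier → Carrier
  map-γ γ x = value γ x (bar x)

  Collision : Carrier → Set (c ⊔ ℓ)
  Collision γ = ∃₂ λ x y → x ≉ y × map-γ γ x ≈ map-γ γ y

  -- Conjugates and difference are passed in simplified form, so that the value identities apply
  -- directly.
  collide : ∀ {γ x y x′ y′ z} → bar x ≈ x′ → bar y ≈ y′ → x - y ≈ z → z ≉ 0# → value γ x x′ ≈ value γ y y′ → Collision γ
  collide {γ} {x} {y} x̄ ȳ x-y≈z z≉0 eq = x , y , (λ x≈y → z≉0 (trans (sym x-y≈z) (x≈y⇒x∙y⁻¹≈ε x≈y))) ,
    trans (value-cong γ x̄) (trans eq (sym (value-cong γ ȳ)))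

  4≉0 : (1# + 1#) * (1# + 1#) ≉ 0#
  4≉0 = x*y≉0 2≉0 2≉0

  collision-trace-zero : ∀ γ → bar γ ≈ - γ → ∀ t → (1# + 1#) * (1# + 1#) * γ * t ≈ 1# → Collision γ
  collision-trace-zero γ γ̄≈-γ t 4γt≈1 = collide (bar-1 ⟨+⟩ t̄≈-t) bar-1
      (solve 1 (λ t → (con 1ℤ :+ t) :- con 1ℤ := t) refl t) (x*y≈1⇒y≉0 4γt≈1)
      (by-relation (- t) 4γt≈1 (value-1+t γ t))
    where
    t̄≈-t : bar t ≈ - t
    t̄≈-t = bar-inverse 4γt≈1 (trans (-x*-y≈x*y′ _ γ t) 4γt≈1) (bar-2 ⟨*⟩ bar-2 ⟨*⟩ γ̄≈-γ)

  collision-generic : ∀ γ → γ ≉ 0# → ∀ z → (γ + bar γ) * (γ + bar γ) * (γ - bar γ) * z ≈ 1# → Collision γ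
  collision-generic γ γ≉0 z TTDz≈1 = collide (z̄≈-z ⟨+⟩ refl) (z̄≈-z ⟨+⟩ (⟨-⟩ refl))
      (solve 2 (λ z γ → (z :+ γ) :- (z :+ :- γ) := con (+ 2) :* γ) refl z γ) (x*y≉0 2≉0 γ≉0)
      (by-relation (- ((1# + 1#) * γ)) TTDz≈1 (value-z±γ γ (bar γ) z))
    where
    z̄≈-z : bar z ≈ - z
    z̄≈-z = bar-inverse TTDz≈1 (trans (swap-conjugates γ (bar γ) z) TTDz≈1)
      ((refl ⟨+⟩ bar-involutive γ) ⟨*⟩ (refl ⟨+⟩ bar-involutive γ) ⟨*⟩ (refl ⟨+⟩ (⟨-⟩ bar-involutive γ)))

  -- For 16γs = 1 and u² = 1, the condition 1 + 16γu(u² + d² - z²/2) = 0 becomes z² = 2(d² - e) with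
  -- e = -(1 + us), which the hypothesis on d and w provides for z = √2 w.
  collision-from-twisted-norm : ∀ γ s u d w → 16· γ * s ≈ 1# → u * u ≈ 1# → bar u ≈ u → bar d ≈ d → d ≉ 0# →
    bar (√2 * w) ≈ - (√2 * w) → d * d ≈ w * w + - (1# + u * s) → Collision γ
  collision-from-twisted-norm γ s u d w 16γs≈1 uu≈1 ū≈u d̄≈d d≉0 z̄≈-z dd≈ww+e = collide
      (ū≈u ⟨+⟩ d̄≈d ⟨+⟩ z̄≈-z) (ū≈u ⟨+⟩ (⟨-⟩ d̄≈d) ⟨+⟩ z̄≈-z)
      (solve 3 (λ u d z → (u :+ d :+ z) :- (u :+ :- d :+ z) := con (+ 2) :* d) refl u d z)
      (x*y≉0 2≉0 d≉0)
      (begin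
        value γ (u + d + z) (u + d + - z)                   ≈⟨ value-split (u + d) ⟩
        (u + d + z) + splitValue γ z² (u + d)               ≈⟨ by-relation _ uu≈1 (by-relation _ 16γs≈1 (split-difference γ u s d z)) ⟩
        (u + - d + z) + splitValue γ z² (u + - d)           ≈⟨ value-split (u + - d) ⟨
        value γ (u + - d + z) (u + - d + - z)               ∎)
      where
      z z² : Carrier
      z = √2 * w
      z² = (1# + 1#) * (d * d - - (1# + u * s))

      z*z≈z² : z * z ≈ z²
      z*z≈z² = by-relation _ √2-square (by-relation _ dd≈ww+e (2[d²+e]-relation √2 w d (- (1# + u * s))))

      value-split : ∀ v → value γ (v + z) (v + - z) ≈ (v + z) + splitValue γ z² v
      value-split v = trans (value-v+z γ v z) (+-congˡ (*-congˡ (+-congˡ (-‿cong z*z≈z²))))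

  -- Since 1 + s and 1 - s add up to 2, they cannot both vanish. The choice secures e ≠ 0 for e =
  -- -(1 + us).
  sign-choice : ∀ s → ∃ λ u → u * u ≈ 1# × bar u ≈ u × 1# + u * s ≉ 0#
  sign-choice s with 1# + 1# * s ≟ 0#
  ... | no  1+s≉0 = 1# , *-identityʳ 1# , bar-1 , 1+s≉0
  ... | yes 1+s≈0 = - 1# , solve 0 (:- con 1ℤ :* :- con 1ℤ := con 1ℤ) refl , ⟨-⟩ bar-1 , λ 1-s≈0 → 2≉0 (begin
    1# + 1#                          ≈⟨ solve 1 (λ s → con (+ 2) := (con 1ℤ :+ con 1ℤ :* s) :+ (con 1ℤ :+ :- con 1ℤ :* s)) refl s ⟩
    (1# + 1# * s) + (1# + - 1# * s)  ≈⟨ +-cong 1+s≈0 1-s≈0 ⟩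
    0# + 0#                          ≈⟨ +-identityʳ 0# ⟩
    0#                               ∎)

  collision-fixed : ∀ γ s → bar γ ≈ γ → 16· γ * s ≈ 1# → Collision γ
  collision-fixed γ s γ̄≈γ 16γs≈1 =
    let u , uu≈1 , ū≈u , 1+us≉0 = sign-choice s
        -- This is the condition e ≠ -1, because 1 + e = -us.
        us≉0 = x*y≉0 (x*y≈1⇒y≉0 uu≈1) (x*y≈1⇒y≉0 16γs≈1)
        d , w , d̄≈d , d≉0 , z̄≈-z , dd≈ww+e = twisted-norm (- (1# + u * s))
          (⟨-⟩ (bar-1 ⟨+⟩ ū≈u ⟨*⟩ s̄≈s)) (-x≉0 1+us≉0) (λ eq → -x≉0 us≉0 (trans (-v≈1-[1+v] (u * s)) eq))
    in collision-from-twisted-norm γ s u d w 16γs≈1 uu≈1 ū≈u d̄≈d d≉0 z̄≈-z dd≈ww+e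
    where
    s̄≈s : bar s ≈ s
    s̄≈s = bar-inverse 16γs≈1 16γs≈1 (bar-2 ⟨*⟩ bar-2 ⟨*⟩ (bar-2 ⟨*⟩ bar-2) ⟨*⟩ γ̄≈γ)

    -v≈1-[1+v] : ∀ v → - v ≈ 1# + - (1# + v)
    -v≈1-[1+v] = solve 1 (λ v → :- v := con 1ℤ :+ :- (con 1ℤ :+ v)) refl

  collision : ∀ γ → γ ≉ 0# → Collision γ
  collision γ γ≉0 = cases (γ + bar γ ≟ 0#) (γ - bar γ ≟ 0#)
    where
    cases : Dec (γ + bar γ ≈ 0#) → Dec (γ - bar γ ≈ 0#) → Collision γ
    cases (yes T≈0) _         =
      let t , 4γt≈1 = inverse _ (x*y≉0 4≉0 γ≉0)
      in collision-trace-zero γ (+-inverseʳ-unique γ (bar γ) T≈0) t 4γt≈1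
    cases (no  T≉0) (no  D≉0) =
      let z , TTDz≈1 = inverse _ (x*y≉0 (x*y≉0 T≉0 T≉0) D≉0)
      in collision-generic γ γ≉0 z TTDz≈1
    cases (no  _)   (yes D≈0) =
      let s , 16γs≈1 = inverse _ (x*y≉0 (x*y≉0 4≉0 4≉0) γ≉0)
      in collision-fixed γ s (sym (x∙y⁻¹≈ε⇒x≈y γ (bar γ) D≈0)) 16γs≈1

-- Squares of odd numbers modulo 8.

odd-form : ∀ {n} → 2 ∤ n → ∃ λ r → n ≡ suc (2 ℕ.* r)
odd-form {zero}        2∤n = contradiction (divides 0 ≡.refl) 2∤n
odd-form {suc zero}    2∤n = 0 , ≡.refl
odd-form {suc (suc n)} 2∤n with odd-form {n} (λ { (divides k ≡.refl) → 2∤n (divides (suc k) ≡.refl) })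
... | r , ≡.refl = suc r , ≡.cong (λ m → suc (suc m)) (≡.sym (ℕ.+-suc r (r ℕ.+ 0)))

triangular : ∀ r → ∃ λ t → r ℕ.* suc r ≡ 2 ℕ.* t
triangular zero    = 0 , ≡.refl
triangular (suc r) with t , eq ← triangular r = t ℕ.+ suc r , (begin
  suc r ℕ.* suc (suc r)          ≡⟨ expand r ⟩
  r ℕ.* suc r ℕ.+ 2 ℕ.* suc r    ≡⟨ ≡.cong (ℕ._+ 2 ℕ.* suc r) eq ⟩
  2 ℕ.* t ℕ.+ 2 ℕ.* suc r        ≡⟨ ℕ.*-distribˡ-+ 2 t (suc r) ⟨
  2 ℕ.* (t ℕ.+ suc r)            ∎)
  where
  open ≡.≡-Reasoning
  expand : ∀ r → suc r ℕ.* suc (suc r) ≡ r ℕ.* suc r ℕ.+ 2 ℕ.* suc r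
  expand = solve-∀

-- For m = r + 1 the square is 1 + 4m(m + 1) with m(m + 1) even. As m is positive, so is the
-- multiple of 8, which therefore has the form `suc t ℕ.* 8`.
odd-square : ∀ r → ∃ λ t → suc (2 ℕ.* suc r) ^ 2 ≡ suc (suc t ℕ.* 8)
odd-square r with triangular (suc r)
... | suc t , eq = t , (begin
  suc (2 ℕ.* suc r) ^ 2                        ≡⟨ expand r ⟩
  suc (4 ℕ.* (suc r ℕ.* suc (suc r)))          ≡⟨ ≡.cong (λ m → suc (4 ℕ.* m)) eq ⟩
  suc (4 ℕ.* (2 ℕ.* suc t))                    ≡⟨ ≡.cong suc (≡.trans (≡.sym (ℕ.*-assoc 4 2 (suc t))) (ℕ.*-comm 8 (suc t))) ⟩
  suc (suc t ℕ.* 8)                            ∎)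
  where
  open ≡.≡-Reasoning
  expand : ∀ r → suc (2 ℕ.* suc r) ℕ.* (suc (2 ℕ.* suc r) ℕ.* 1) ≡ suc (4 ℕ.* (suc r ℕ.* suc (suc r)))
  expand = solve-∀

-- A square root of 2 from an eighth root of unity.

module SquareRootOfTwo {c ℓ : Level} {n : ℕ} (F : FiniteField c ℓ n) {t : ℕ} (n≡1+8[1+t] : n ≡ suc (suc t ℕ.* 8)) where
  open FiniteField F hiding (zero)
  open FiniteFields F
  open import Algebra.Properties.CommutativeSemiring.Exp commutativeSemiring using (^-assocʳ; ^-homo-*) renaming (_^_ to _^ᶠ_)
  open import Algebra.Properties.Ring ring using (x∙y⁻¹≈ε⇒x≈y; x≈y⇒x∙y⁻¹≈ε)
  open import Relation.Binary.Reasoning.Setoid setoid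
  open IntegerSolver commutativeRing

  -- An element ζ with ζ⁴ = −1 is an eighth root of unity, and (ζ + ζ⁻¹)² = 2 with ζ⁻¹ = −ζ³.
  √2-exists : ∃ λ m → m * m ≈ 1# + 1#
  √2-exists with monic-nonroot
      -- A nonroot of y (y ^ ((n - 1) / 2) - 1) is nonzero, and its power w with exponent (n - 1) /
      -- 2 is not 1. Since w² = 1, this forces w = -1, and w is the fourth power of ζ.
      (horner 0# (monic-+ (- 1#) (monic-^ (suc t ℕ.* 4))) (λ _ → sym (+-identityʳ _)))
      (≡.subst (suc (suc t ℕ.* 4) ℕ.<_) (≡.sym n≡1+8[1+t]) (s≤s (ℕ.*-monoʳ-< (suc t) (ℕ.m≤m+n 5 3))))
  ... | y , y[y⁴ᵗ-1]≉0 = ζ - ζ * ζ * ζ , (begin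
      (ζ - ζ * ζ * ζ) * (ζ - ζ * ζ * ζ)
        ≈⟨ solve 1 (λ z → (z :- z :* z :* z) :* (z :- z :* z :* z)
             := con (+ 2) :+ (z :* z :- con (+ 2)) :* (z :* (z :* (z :* (z :* con 1ℤ))) :+ con 1ℤ)) refl ζ ⟩
      1# + 1# + (ζ * ζ - (1# + 1#)) * (ζ ^ᶠ 4 + 1#)
        ≈⟨ +-congˡ (*-congˡ ζ⁴+1≈0) ⟩
      1# + 1# + (ζ * ζ - (1# + 1#)) * 0#
        ≈⟨ trans (+-congˡ (zeroʳ _)) (+-identityʳ _) ⟩
      1# + 1#  ∎)
    where
    ζ = y ^ᶠ suc t
    w = y ^ᶠ (suc t ℕ.* 4)

    y≉0 : y ≉ 0#
    y≉0 y≈0 = y[y⁴ᵗ-1]≉0 (trans (*-congʳ y≈0) (zeroˡ _))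

    w-1≉0 : w - 1# ≉ 0#
    w-1≉0 eq = y[y⁴ᵗ-1]≉0 (trans (*-congˡ eq) (zeroʳ _))

    w²≈1 : w * w ≈ 1#
    w²≈1 = begin
      w * w                                  ≈⟨ ^-homo-* y (suc t ℕ.* 4) (suc t ℕ.* 4) ⟨
      y ^ᶠ (suc t ℕ.* 4 ℕ.+ suc t ℕ.* 4)     ≡⟨ ≡.cong (y ^ᶠ_) (≡.sym (ℕ.*-distribˡ-+ (suc t) 4 4)) ⟩
      y ^ᶠ (suc t ℕ.* 8)                     ≈⟨ x^[n-1]≈1 n≡1+8[1+t] y≉0 ⟩
      1#                                     ∎

    ζ⁴+1≈0 : ζ ^ᶠ 4 + 1# ≈ 0#
    ζ⁴+1≈0 = x*y≈0⇒y≈0 w-1≉0 (begin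
      (w - 1#) * (ζ ^ᶠ 4 + 1#)   ≈⟨ *-congˡ (+-congʳ (^-assocʳ y (suc t) 4)) ⟩
      (w - 1#) * (w + 1#)        ≈⟨ solve 1 (λ w → (w :- con 1ℤ) :* (w :+ con 1ℤ) := w :* w :- con 1ℤ) refl w ⟩
      w * w - 1#                 ≈⟨ x≈y⇒x∙y⁻¹≈ε w²≈1 ⟩
      0#                         ∎)

-- The norm and the involution x ↦ x ^ q of a quadratic extension.

module QuadraticExtension {c ℓ : Level} (j : ℕ) (F : FiniteField c ℓ (suc (suc j) ^ 2)) where
  open FiniteField F hiding (zero)
  open FiniteFields F
  open import Algebra.Properties.CommutativeSemiring.Exp commutativeSemiring using (^-assocʳ; ^-congˡ) renaming (_^_ to _^ᶠ_)
  open import Algebra.Properties.Ring ring using (x∙y⁻¹≈ε⇒x≈y; x≈y⇒x∙y⁻¹≈ε)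
  open import Relation.Binary.Reasoning.Setoid setoid
  open IntegerSolver commutativeRing

  q : ℕ
  q = suc (suc j)

  -- With p = x ^ (q + 1) this is the geometric sum of all p ^ a e ^ b with a + b = i, the quotient
  -- of p ^ (i + 1) - e ^ (i + 1) by p - e.
  cofactor : Carrier → ℕ → Carrier → Carrier
  cofactor e zero    x = 1#
  cofactor e (suc i) x = x ^ᶠ suc q * cofactor e i x + e ^ᶠ suc i

  cofactor-monic : ∀ e i → Monic (i ℕ.* suc q) (cofactor e i)
  cofactor-monic e zero    = one (λ _ → refl)
  cofactor-monic e (suc i) = monic-+ (e ^ᶠ suc i) (monic-shift (suc q) (cofactor-monic e i))

  cofactor-geometric : ∀ e i x → (x ^ᶠ suc q - e) * cofactor e i x ≈ (x ^ᶠ suc q) ^ᶠ suc i - e ^ᶠ suc i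
  cofactor-geometric e zero    x = solve 2 (λ p e → (p :- e) :* con 1ℤ := p :* con 1ℤ :- e :* con 1ℤ) refl (x ^ᶠ suc q) e
  cofactor-geometric e (suc i) x = begin
    (p - e) * (p * cofactor e i x + e ^ᶠ suc i)
      ≈⟨ solve 4 (λ p e k l → (p :- e) :* (p :* k :+ l) := p :* ((p :- e) :* k) :+ (p :- e) :* l) refl p e (cofactor e i x) (e ^ᶠ suc i) ⟩
    p * ((p - e) * cofactor e i x) + (p - e) * e ^ᶠ suc i
      ≈⟨ +-congʳ (*-congˡ (cofactor-geometric e i x)) ⟩
    p * (p ^ᶠ suc i - e ^ᶠ suc i) + (p - e) * e ^ᶠ suc i
      ≈⟨ solve 4 (λ p e k l → p :* (k :- l) :+ (p :- e) :* l := p :* k :- e :* l) refl p e (p ^ᶠ suc i) (e ^ᶠ suc i) ⟩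
    p ^ᶠ suc (suc i) - e ^ᶠ suc (suc i)   ∎
    where p = x ^ᶠ suc q

  -- The factorisation q² - 1 = (q - 1)(q + 1), with q - 1 written as `suc j` to avoid truncated
  -- subtraction.
  q²≡1+[1+j][1+q] : q ^ 2 ≡ suc (suc j ℕ.* suc q)
  q²≡1+[1+j][1+q] = expand j
    where
    expand : ∀ j → suc (suc j) ℕ.* (suc (suc j) ℕ.* 1) ≡ suc (suc j ℕ.* suc (suc (suc j)))
    expand = solve-∀

  -- The cofactor of x ^ (q + 1) − e in x ^ (q² − 1) − 1 has too small a degree to vanish at all x ≠ 0.
  norm-surjective : ∀ e → e ^ᶠ q ≈ e → e ≉ 0# → ∃ λ y → y * y ^ᶠ q ≈ e
  norm-surjective e e^q≈e e≉0 with monic-nonroot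
      -- The added root 0 keeps y nonzero; the degree becomes 1 + j(q + 1), still below q² = 1 + (j
      -- + 1)(q + 1).
      (horner 0# (cofactor-monic e j) (λ _ → sym (+-identityʳ _)))
      (≡.subst (suc (j ℕ.* suc q) ℕ.<_) (≡.sym q²≡1+[1+j][1+q]) (s≤s (ℕ.m<n+m (j ℕ.* suc q) (s≤s z≤n))))
  ... | y , yc≉0 = y , x∙y⁻¹≈ε⇒x≈y _ _ (x*y≈0⇒y≈0 c≉0 (begin
      cofactor e j y * (y ^ᶠ suc q - e)           ≈⟨ *-comm _ _ ⟩
      (y ^ᶠ suc q - e) * cofactor e j y           ≈⟨ cofactor-geometric e j y ⟩
      (y ^ᶠ suc q) ^ᶠ suc j - e ^ᶠ suc j          ≈⟨ x≈y⇒x∙y⁻¹≈ε (trans y-power (sym e-power)) ⟩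
      0#                                          ∎))
    where
    y≉0 : y ≉ 0#
    y≉0 y≈0 = yc≉0 (trans (*-congʳ y≈0) (zeroˡ _))

    c≉0 : cofactor e j y ≉ 0#
    c≉0 eq = yc≉0 (trans (*-congˡ eq) (zeroʳ _))

    y-power : (y ^ᶠ suc q) ^ᶠ suc j ≈ 1#
    y-power = begin
      (y ^ᶠ suc q) ^ᶠ suc j      ≈⟨ ^-assocʳ y (suc q) (suc j) ⟩
      y ^ᶠ (suc q ℕ.* suc j)     ≡⟨ ≡.cong (y ^ᶠ_) (ℕ.*-comm (suc q) (suc j)) ⟩
      y ^ᶠ (suc j ℕ.* suc q)     ≈⟨ x^[n-1]≈1 q²≡1+[1+j][1+q] y≉0 ⟩
      1#                         ∎

    -- Since `suc j` is q - 1, the hypothesis on e unfolds to `e * e ^ᶠ suc j ≈ e`, and e cancels.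
    e-power : e ^ᶠ suc j ≈ 1#
    e-power = *-cancelˡ-nonzero e≉0 (trans e^q≈e (sym (*-identityʳ e)))

  ^q-involutive : ∀ x → (x ^ᶠ q) ^ᶠ q ≈ x
  ^q-involutive x = begin
    (x ^ᶠ q) ^ᶠ q      ≈⟨ ^-assocʳ x q q ⟩
    x ^ᶠ (q ℕ.* q)     ≡⟨ ≡.cong (λ m → x ^ᶠ (q ℕ.* m)) (≡.sym (ℕ.*-identityʳ q)) ⟩
    x ^ᶠ (q ^ 2)       ≈⟨ x^n≈x x ⟩
    x                  ∎

-- The polynomial in terms of norm and trace.

module TracePolynomial {c ℓ : Level} (q : ℕ) (F : FiniteField c ℓ (q ^ 2)) where
  open FiniteField F hiding (zero)
  open Polynomials commutativeRing using (eval; IsPermutationPolynomial)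
  open import Algebra.Properties.CommutativeSemiring.Exp commutativeSemiring using (^-assocʳ; ^-congˡ; ^-homo-*; ^-distrib-*) renaming (_^_ to _^ᶠ_)
  open import Relation.Binary.Reasoning.Setoid setoid
  open IntegerSolver commutativeRing

  -- The argument of the trace is x̄x³ + x̄²x². Adding its conjugate gives x x̄ (x² + 2x x̄ + x̄²).
  eval-norm-trace : (∀ x y → (x + y) ^ᶠ q ≈ x ^ᶠ q + y ^ᶠ q) → (∀ x → (x ^ᶠ q) ^ᶠ q ≈ x) → ∀ γ x →
    eval (tracePolynomial q F γ) x ≈ x + γ * (x * x ^ᶠ q * ((x + x ^ᶠ q) * (x + x ^ᶠ q)))
  eval-norm-trace ^q-+ ^q-involutive γ x = trans (eval-tracePolynomial q F γ x) (+-congˡ (*-congˡ (begin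
    g + g ^ᶠ q                              ≈⟨ +-cong g≈ (trans (^-congˡ q g≈) g^q≈) ⟩
    h x x̄ + h x̄ x                           ≈⟨ symmetric x x̄ ⟩
    x * x̄ * ((x + x̄) * (x + x̄))             ∎)))
    where
    x̄ = x ^ᶠ q
    g = x ^ᶠ (q ℕ.+ 3) + x ^ᶠ (2 ℕ.* q ℕ.+ 2)

    h : Carrier → Carrier → Carrier
    h x y = y * (x * x * x) + y * y * (x * x)

    symmetric : ∀ x y → h x y + h y x ≈ x * y * ((x + y) * (x + y))
    symmetric = solve 2 (λ x y → y :* (x :* x :* x) :+ y :* y :* (x :* x) :+ (x :* (y :* y :* y) :+ x :* x :* (y :* y))
      := x :* y :* ((x :+ y) :* (x :+ y))) refl

    g≈ : g ≈ h x x̄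
    g≈ = +-cong
      (trans (^-homo-* x q 3) (*-congˡ (solve 1 (λ x → x :* (x :* (x :* con 1ℤ)) := x :* x :* x) refl x)))
      (trans (^-homo-* x (2 ℕ.* q) 2) (*-cong
        (trans (^-homo-* x q (q ℕ.+ 0)) (*-congˡ (reflexive (≡.cong (x ^ᶠ_) (ℕ.+-identityʳ q)))))
        (*-congˡ (*-identityʳ x))))

    infixl 7 _⟨*⟩_
    _⟨*⟩_ : ∀ {x y x′ y′} → x ^ᶠ q ≈ x′ → y ^ᶠ q ≈ y′ → (x * y) ^ᶠ q ≈ x′ * y′
    p ⟨*⟩ r = trans (^-distrib-* _ _ q) (*-cong p r)

    g^q≈ : h x x̄ ^ᶠ q ≈ h x̄ x
    g^q≈ = trans (^q-+ _ _) (+-cong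
      (^q-involutive x ⟨*⟩ (refl ⟨*⟩ refl ⟨*⟩ refl))
      (^q-involutive x ⟨*⟩ ^q-involutive x ⟨*⟩ (refl ⟨*⟩ refl)))

  permutation-zero : ∀ γ → γ ≈ 0# → IsPermutationPolynomial (tracePolynomial q F γ)
  permutation-zero γ γ≈0 = (λ eq → trans (sym (eval≈ _)) (trans eq (eval≈ _))) , λ y → y , λ z≈y → trans (eval≈ _) z≈y
    where
    eval≈ : ∀ x → eval (tracePolynomial q F γ) x ≈ x
    eval≈ x = trans (eval-tracePolynomial q F γ x)
      (trans (+-congˡ (trans (*-congʳ γ≈0) (zeroˡ _))) (+-identityʳ x))

-- The fields of order q² with q odd.

no-field-of-order-1 : ∀ {c ℓ} → ¬ FiniteField c ℓ 1
no-field-of-order-1 F = 1≉0 (to-injective (Fin1-unique _ _))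
  where
  open FiniteField F
  open FiniteFields F
  Fin1-unique : (i k : Fin 1) → i ≡ k
  Fin1-unique zero zero = ≡.refl

module OddQuadraticExtension {c ℓ : Level} (r : ℕ)
  (p k : ℕ) (p-prime : Prime p) (q≡p^k : suc (2 ℕ.* suc r) ≡ p ^ k)
  (F : FiniteField c ℓ (suc (2 ℕ.* suc r) ^ 2)) where
  open FiniteField F hiding (zero)
  open FiniteFields F
  open import Algebra.Properties.CommutativeSemiring.Exp commutativeSemiring using (^-congˡ; ^-distrib-*) renaming (_^_ to _^ᶠ_)
  open import Algebra.Properties.Semiring.Mult semiring using () renaming (_×_ to _·_)
  open import Relation.Binary.Reasoning.Setoid setoid
  -- For this j, which is 2r + 1, `suc (suc j)` reduces to q, so the field can be passed on
  -- unchanged.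
  open QuadraticExtension (r ℕ.+ suc (r ℕ.+ 0)) F using (norm-surjective; ^q-involutive)
  open Frobenius commutativeSemiring using (frobenius-iterate; multiple-vanishes)

  q : ℕ
  q = suc (2 ℕ.* suc r)

  -- The order is p ^ (2k), so p · 1 = 0 and the q-th power is the k-fold iterate of the Frobenius
  -- map.
  ^q-+ : ∀ x y → (x + y) ^ᶠ q ≈ x ^ᶠ q + y ^ᶠ q
  ^q-+ x y = ≡.subst (λ m → (x + y) ^ᶠ m ≈ x ^ᶠ m + y ^ᶠ m) (≡.sym q≡p^k)
    (frobenius-iterate p-prime (characteristic {p} {k ℕ.* 2} (≡.trans (≡.cong (_^ 2) q≡p^k) (ℕ.^-*-assoc p k 2))) k x y)

  -- The order q² annihilates 1 and is odd, so 2 = 0 would entail 1 = 0.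
  2≉0 : 1# + 1# ≉ 0#
  2≉0 2≈0 with t , q²≡1+8t ← odd-square r = 1≉0 (begin
    1#                          ≈⟨ +-identityʳ 1# ⟨
    1# + 0#                     ≈⟨ +-congˡ (multiple-vanishes {2} {suc t ℕ.* 8} (trans (+-congˡ (+-identityʳ 1#)) 2≈0)
                                     (divides (suc t ℕ.* 4) (≡.sym (ℕ.*-assoc (suc t) 4 2))) 1#) ⟨
    suc (suc t ℕ.* 8) · 1#      ≡⟨ ≡.cong (_· 1#) q²≡1+8t ⟨
    (q ^ 2) · 1#                ≈⟨ n·1≈0 ⟩
    0#                          ∎)

  √2-exists : ∃ λ m → m * m ≈ 1# + 1#
  √2-exists with t , q²≡1+8t ← odd-square r = SquareRootOfTwo.√2-exists F {t} q²≡1+8t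

  conjugation : ConjugationWith√2 F
  conjugation = record
    { 2≉0             = 2≉0
    ; √2              = proj₁ √2-exists
    ; √2-square       = proj₂ √2-exists
    ; bar             = _^ᶠ q
    ; bar-cong        = ^-congˡ q
    ; bar-+           = ^q-+
    ; bar-*           = λ x y → ^-distrib-* x y q
    ; bar-involutive  = ^q-involutive
    ; norm-surjective = norm-surjective
    }

  open Collisions F conjugation using (collision)
  open Polynomials commutativeRing using (IsPermutationPolynomial)

  permutation⇒zero : ∀ γ → IsPermutationPolynomial (tracePolynomial q F γ) → γ ≈ 0#
  -- Equality is decidable, so it suffices that γ ≠ 0 contradicts injectivity.
  permutation⇒zero γ (injective , _) = decidable-stable (γ ≟ 0#) λ γ≉0 →
    let x , y , x≉y , eq = collision γ γ≉0
        eval≈ = TracePolynomial.eval-norm-trace q F ^q-+ ^q-involutive γ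
    in x≉y (injective (trans (eval≈ x) (trans eq (sym (eval≈ y)))))

corollary3p3 : ∀ {c ℓ : Level} (q : ℕ) → IsPrimePower q → 2 ∤ q →
    (F : FiniteField c ℓ (q ^ 2)) → let open FiniteField F in let open Polynomials commutativeRing in
    (γ : Carrier) → IsPermutationPolynomial (tracePolynomial q F γ) ⇔ γ ≈ 0#
corollary3p3 q (p , k , p-prime , _ , q≡p^k) 2∤q F γ with odd-form 2∤q
-- Here q = 1, and a field with a single element would have 1 = 0.
... | zero  , ≡.refl = contradiction F no-field-of-order-1
... | suc r , ≡.refl = mk⇔ (OddQuadraticExtension.permutation⇒zero r p k p-prime q≡p^k F γ) (TracePolynomial.permutation-zero q F γ)
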